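{- Let $n\equiv 1 \pmod 4$ with $n\ge 5$, and suppose there exists a reverse Gray code for the permutations of $\{1,\ldots,n-1\}$ with property $P$. Then there exists a reverse Gray code for the permutations of $\{1,\ldots,n\}$.
   Context: A reverse Gray code for the permutations of $\{1,\ldots,m\}$ is a listing $\pi_0,\ldots,\pi_{m!-1}$ of all permutations of $\{1,\ldots,m\}$ written as words, such that consecutive permutations differ by interchanging the symbols in two adjacent positions, and $\pi_{i+m!/2}$ is the reversal of $\pi_i$ (the word read backwards) for all $0\le i<m!/2$. Such a code has property $P$ if $\pi_0=12\cdots m$ and the four permutations immediately preceding $\pi_{m!/2}$ are, in order, $(m-1)(m-2)(m-3)\,m\,(m-4)\cdots 3\,1\,2$, then $(m-1)(m-2)\,m\,(m-3)(m-4)\cdots 3\,1\,2$, then $(m-1)\,m\,(m-2)(m-3)(m-4)\cdots 3\,1\,2$, then $m(m-1)(m-2)(m-3)(m-4)\cdots 3\,1\,2$. -}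

module Defs where

open import Data.Fin.Base using (Fin; toℕ)
open import Data.List.Base
  using (List; []; _∷_; _++_; applyUpTo; applyDownFrom; take; drop; reverse)
open import Data.List.Relation.Binary.Permutation.Propositional using (_↭_)
open import Data.Nat.Base using (ℕ; suc; _+_; _∸_; _!)
open import Data.Nat.DivMod using (_/_)
open import Data.Product.Base using (∃-syntax; _×_)
open import Function.Definitions using (Injective)
open import Relation.Binary.PropositionalEquality using (_≡_)

Word : Set
Word = List ℕ

-- 1 2 ⋯ m
identityWord : ℕ → Word
identityWord m = applyUpTo suc m

IsPermutationWord : ℕ → Word → Set
IsPermutationWord m w = w ↭ identityWord m

AdjacentSwap : Word → Word → Set
AdjacentSwap v w =
  ∃[ xs ] ∃[ a ] ∃[ b ] ∃[ ys ]
    (v ≡ xs ++ a ∷ b ∷ ys × w ≡ xs ++ b ∷ a ∷ ys)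

Listing : ℕ → Set
Listing m = Fin (m !) → Word

record IsReverseGrayCode (m : ℕ) (π : Listing m) : Set where
  field
    permutations : ∀ i → IsPermutationWord m (π i)
    distinct     : Injective _≡_ _≡_ π
    exhaustive   : ∀ w → IsPermutationWord m w → ∃[ i ] π i ≡ w
    adjacent     : ∀ i j → toℕ j ≡ suc (toℕ i) → AdjacentSwap (π i) (π j)
    -- j ranges over Fin (m !), which forces i < m ! / 2 when m ≥ 2.
    reversal     : ∀ i j → toℕ j ≡ toℕ i + m ! / 2 → π j ≡ reverse (π i)

-- (m-1) (m-2) ⋯ 4 3 1 2, of length m-1 (for m ≥ 3)
baseWord : ℕ → Word
baseWord m = applyDownFrom (3 +_) (m ∸ 3) ++ 1 ∷ 2 ∷ []

-- baseWord m with the symbol m inserted after its first k entries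
insertTop : ℕ → ℕ → Word
insertTop m k = take k (baseWord m) ++ m ∷ drop k (baseWord m)

-- Intended for m ≥ 4, where m ! / 2 ≥ 4 and hence all the indices below exist.
-- For m = 4 the four preceding words are 3124, 3142, 3412, 4312.
record PropertyP (m : ℕ) (π : Listing m) : Set where
  field
    starts : ∀ i → toℕ i ≡ 0 → π i ≡ identityWord m
    fourth-before : ∀ i → toℕ i + 4 ≡ m ! / 2 → π i ≡ insertTop m 3
    third-before  : ∀ i → toℕ i + 3 ≡ m ! / 2 → π i ≡ insertTop m 2
    second-before : ∀ i → toℕ i + 2 ≡ m ! / 2 → π i ≡ insertTop m 1
    first-before  : ∀ i → toℕ i + 1 ≡ m ! / 2 → π i ≡ insertTop m 0

{-# OPTIONS --safe #-}
module Submission where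

-- Put R = (n-1)!/2 and insert the symbol n in all n positions of each of the
-- first R words of the given code.  This gives an R × n array; neighbours in a
-- row are adjacent swaps, and so are vertical neighbours unless n sits between
-- the two swapped symbols, in particular always in the outer columns.  It
-- suffices to find a Hamiltonian path from (0, last column) to (R-1, first
-- column): the reversals of its words then follow it in the same order.
-- The first R-3 rows, an odd number, are traversed boustrophedonically.  This
-- brings n to the front, while it has to be in front at the end of row R-1 as
-- well, so three rows remain to be crossed with both ends in the first column.
-- Writing z = n-1, property P says these rows come from A = x y z u, B = x z y u,
-- C = z x y u.  With a, b, c the rows and indices the columns, use
--   a0 b0 b1 a1 a2 ⋯ am bm cm c(m-1) b(m-1) b(m-2) c(m-2) ⋯ b2 c2 c1 c0,  m = n-1 even.

open import Defs
open import Data.Fin.Base using (Fin; zero; suc; toℕ; fromℕ; fromℕ<; cast; _↑ˡ_; _↑ʳ_)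
open import Data.Fin.Properties
  using (toℕ-injective; toℕ-fromℕ; toℕ-fromℕ<; toℕ-↑ˡ; toℕ-↑ʳ; toℕ<n; toℕ-cast; cast-involutive)
open import Data.List.Base
  using (List; []; _∷_; [_]; _++_; map; concatMap; filter; length; lookup; reverse; tabulate;
         applyDownFrom; take; drop)
open import Data.List.Membership.Propositional using (_∈_; find; lose)
open import Data.List.Membership.Propositional.Properties
  using (∈-map⁺; ∈-map⁻; ∈-++⁺ʳ; ∈-∃++; ∈-concatMap⁺; ∈-concatMap⁻; ∈-lookup; ∈-tabulate⁺; ∈-tabulate⁻)
open import Data.List.Properties
  using (++-assoc; ++-identityʳ; ∷-injectiveˡ; ∷-injectiveʳ; concatMap-++; filter-accept;
         filter-all; filter-reject; length-++; length-map; length-reverse; length-tabulate;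
         length-applyUpTo; length-applyDownFrom; map-++; map-∘; map-tabulate; reverse-++; tabulate-cong;
         unfold-reverse; applyUpTo-∷ʳ)
open import Data.List.Relation.Binary.Disjoint.Propositional using (Disjoint)
open import Data.List.Relation.Binary.Permutation.Propositional
  using (_↭_; prep; swap; ↭-refl; ↭-reflexive; ↭-sym; ↭-trans; module PermutationReasoning)
open import Data.List.Relation.Binary.Permutation.Propositional.Properties
  using (All-resp-↭; ∈-resp-↭; ↭-length; ↭-reverse; ++⁺; ++⁺ˡ; ++⁺ʳ; drop-mid; map⁺; shift; shifts;
         ++-comm; ∷↭∷ʳ)
open import Data.List.Relation.Unary.All as All using (All; []; _∷_)
import Data.List.Relation.Unary.All.Properties as All
open import Data.List.Relation.Unary.AllPairs using (AllPairs; []; _∷_)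
import Data.List.Relation.Unary.AllPairs.Properties as AllPairs
open import Data.List.Relation.Unary.Any using (here; there; index)
open import Data.List.Relation.Unary.Any.Properties using (lookup-index)
open import Data.List.Relation.Unary.Unique.Propositional using (Unique)
import Data.List.Relation.Unary.Unique.Propositional.Properties as Unique
open import Data.Nat.Base
open import Data.Nat.DivMod using (_%_; _/_; m*n/n≡m; m≡m%n+[m/n]*n)
open import Data.Nat.Divisibility using (_∣_; divides; m≤n⇒m!∣n!)
open import Data.Nat.Properties
open import Data.Nat.Tactic.RingSolver using (solve-∀)
open import Data.Product.Base using (∃-syntax; ∃₂; _×_; _,_)
open import Function.Base using (_∘_)
open import Function.Definitions using (Injective)
open import Relation.Binary.PropositionalEquality
  using (_≡_; _≢_; refl; sym; trans; cong; cong₂; subst; subst₂; module ≡-Reasoning)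
open import Relation.Nullary using (¬?; contradiction)

-- Adjacent swaps and paths of words.

AdjacentSwap-sym : ∀ {v w} → AdjacentSwap v w → AdjacentSwap w v
AdjacentSwap-sym (xs , a , b , ys , p , q) = xs , b , a , ys , q , p

AdjacentSwap-∷ : ∀ x {v w} → AdjacentSwap v w → AdjacentSwap (x ∷ v) (x ∷ w)
AdjacentSwap-∷ x (xs , a , b , ys , refl , refl) = x ∷ xs , a , b , ys , refl , refl

AdjacentSwap-++ʳ : ∀ zs {v w} → AdjacentSwap v w → AdjacentSwap (v ++ zs) (w ++ zs)
AdjacentSwap-++ʳ zs (xs , a , b , ys , refl , refl) =
  xs , a , b , ys ++ zs , ++-assoc xs _ zs , ++-assoc xs _ zs

AdjacentSwap-head : ∀ a b ys → AdjacentSwap (a ∷ b ∷ ys) (b ∷ a ∷ ys)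
AdjacentSwap-head a b ys = [] , a , b , ys , refl , refl

reverse-swap : ∀ xs (a b : ℕ) ys →
  reverse (xs ++ a ∷ b ∷ ys) ≡ reverse ys ++ b ∷ a ∷ reverse xs
reverse-swap xs a b ys = begin
  reverse (xs ++ a ∷ b ∷ ys)                ≡⟨ reverse-++ xs (a ∷ b ∷ ys) ⟩
  reverse (a ∷ b ∷ ys) ++ reverse xs        ≡⟨ cong (_++ reverse xs) (reverse-++ (a ∷ b ∷ []) ys) ⟩
  (reverse ys ++ b ∷ a ∷ []) ++ reverse xs  ≡⟨ ++-assoc (reverse ys) _ _ ⟩
  reverse ys ++ b ∷ a ∷ reverse xs          ∎
  where open ≡-Reasoning

AdjacentSwap-reverse : ∀ {v w} → AdjacentSwap v w → AdjacentSwap (reverse v) (reverse w)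
AdjacentSwap-reverse (xs , a , b , ys , refl , refl) =
  reverse ys , b , a , reverse xs , reverse-swap xs a b ys , reverse-swap xs b a ys

-- The endpoints are indices of the type, so that gluing two paths asks for just one swap between
-- known words.
data Path : Word → List Word → Word → Set where
  end : ∀ v → Path v (v ∷ []) v
  _∷_ : ∀ {v v′ w ws} → AdjacentSwap v v′ → Path v′ ws w → Path v (v ∷ ws) w

infixr 5 _∷_ _++⟨_⟩_

_++⟨_⟩_ : ∀ {v v′ w w′ vs ws} →
  Path v vs v′ → AdjacentSwap v′ w → Path w ws w′ → Path v (vs ++ ws) w′
end v   ++⟨ s ⟩ q = s ∷ q
(t ∷ p) ++⟨ s ⟩ q = t ∷ (p ++⟨ s ⟩ q)

Path-map : ∀ {f} → (∀ {v w} → AdjacentSwap v w → AdjacentSwap (f v) (f w)) →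
  ∀ {v vs w} → Path v vs w → Path (f v) (map f vs) (f w)
Path-map f-swap (end v) = end _
Path-map f-swap (s ∷ p) = f-swap s ∷ Path-map f-swap p

Path-reverse : ∀ {v vs w} → Path v vs w → Path w (reverse vs) v
Path-reverse (end v) = end v
Path-reverse (_∷_ {v} {ws = vs} s p) =
  subst (λ us → Path _ us v) (sym (unfold-reverse v vs))
    (Path-reverse p ++⟨ AdjacentSwap-sym s ⟩ end v)

Path-head : ∀ {v vs w} → Path v vs w → ∀ i → toℕ i ≡ 0 → lookup vs i ≡ v
Path-head (end v) zero _ = refl
Path-head (s ∷ p) zero _ = refl

Path-lookup : ∀ {v vs w} → Path v vs w →
  ∀ i j → toℕ j ≡ suc (toℕ i) → AdjacentSwap (lookup vs i) (lookup vs j)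
Path-lookup (end v) zero    zero    ()
Path-lookup (s ∷ p) zero    (suc j) eq =
  subst (AdjacentSwap _) (sym (Path-head p j (suc-injective eq))) s
Path-lookup (s ∷ p) (suc i) (suc j) eq = Path-lookup p i j (suc-injective eq)

Path-tabulate : ∀ k (f : Fin (suc k) → Word) →
  (∀ i j → toℕ j ≡ suc (toℕ i) → AdjacentSwap (f i) (f j)) →
  Path (f zero) (tabulate f) (f (fromℕ k))
Path-tabulate zero    f f-swap = end (f zero)
Path-tabulate (suc k) f f-swap =
  f-swap zero (suc zero) refl ∷
  Path-tabulate k (f ∘ suc) (λ i j eq → f-swap (suc i) (suc j) (cong suc eq))

-- Indexing, splitting and uniqueness of lists.

module _ {A : Set} where

  lookup-++ˡ : ∀ (xs ys : List A) i a → toℕ i ≡ toℕ a → lookup (xs ++ ys) i ≡ lookup xs a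
  lookup-++ˡ (x ∷ xs) ys zero    zero    eq = refl
  lookup-++ˡ (x ∷ xs) ys (suc i) (suc a) eq = lookup-++ˡ xs ys i a (suc-injective eq)

  lookup-++ʳ : ∀ (xs ys : List A) i b → toℕ i ≡ length xs + toℕ b →
    lookup (xs ++ ys) i ≡ lookup ys b
  lookup-++ʳ []       ys i       b eq = cong (lookup ys) (toℕ-injective eq)
  lookup-++ʳ (x ∷ xs) ys (suc i) b eq = lookup-++ʳ xs ys i b (suc-injective eq)

  lookup-map : ∀ (f : A → A) xs i a → toℕ i ≡ toℕ a → lookup (map f xs) i ≡ f (lookup xs a)
  lookup-map f (x ∷ xs) zero    zero    eq = refl
  lookup-map f (x ∷ xs) (suc i) (suc a) eq = lookup-map f xs i a (suc-injective eq)

  lookup-++-map : ∀ (f : A → A) xs i j → toℕ j ≡ toℕ i + length xs →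
    lookup (xs ++ map f xs) j ≡ f (lookup (xs ++ map f xs) i)
  lookup-++-map f xs i j eq = begin
    lookup (xs ++ map f xs) j      ≡⟨ lookup-++ʳ xs _ j b (trans eq
                                        (trans (+-comm (toℕ i) _) (cong (length xs +_) (sym tb)))) ⟩
    lookup (map f xs) b            ≡⟨ lookup-map f xs b a (trans tb (sym ta)) ⟩
    f (lookup xs a)                ≡⟨ cong f (lookup-++ˡ xs _ i a (sym ta)) ⟨
    f (lookup (xs ++ map f xs) i)  ∎
    where
    open ≡-Reasoning
    -- The bound comes from `j`, which is `toℕ i` plus `length xs` and lies below twice `length xs`.
    i<xs : toℕ i < length xs
    i<xs = +-cancelʳ-< (length xs) _ _
      (subst₂ _<_ eq (trans (length-++ xs) (cong (length xs +_) (length-map f xs))) (toℕ<n j))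
    i<ys = subst (toℕ i <_) (sym (length-map f xs)) i<xs
    a = fromℕ< i<xs
    b = fromℕ< i<ys
    ta = toℕ-fromℕ< i<xs
    tb = toℕ-fromℕ< i<ys

  tabulate-+ : ∀ a b (f : Fin (a + b) → A) →
    tabulate f ≡ tabulate (λ i → f (i ↑ˡ b)) ++ tabulate (λ j → f (a ↑ʳ j))
  tabulate-+ zero    b f = refl
  tabulate-+ (suc a) b f = cong (f zero ∷_) (tabulate-+ a b (f ∘ suc))

  Unique-resp-↭ : ∀ {xs ys : List A} → xs ↭ ys → Unique xs → Unique ys
  Unique-resp-↭ _↭_.refl u = u
  Unique-resp-↭ (prep x p) (x∉ ∷ u) = All-resp-↭ p x∉ ∷ Unique-resp-↭ p u
  Unique-resp-↭ (swap x y p) ((x≢y ∷ x∉) ∷ y∉ ∷ u) =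
    ((x≢y ∘ sym) ∷ All-resp-↭ p y∉) ∷ All-resp-↭ p x∉ ∷ Unique-resp-↭ p u
  Unique-resp-↭ (_↭_.trans p q) u = Unique-resp-↭ q (Unique-resp-↭ p u)

  Unique-lookup-injective : ∀ {xs : List A} → Unique xs → Injective _≡_ _≡_ (lookup xs)
  Unique-lookup-injective (x∉ ∷ u) {zero}  {zero}  eq = refl
  Unique-lookup-injective (x∉ ∷ u) {zero}  {suc j} eq = contradiction eq (All.lookup x∉ (∈-lookup j))
  Unique-lookup-injective (x∉ ∷ u) {suc i} {zero}  eq =
    contradiction (sym eq) (All.lookup x∉ (∈-lookup i))
  Unique-lookup-injective (x∉ ∷ u) {suc i} {suc j} eq = cong suc (Unique-lookup-injective u eq)

double/2 : ∀ {n r} → n ≡ r + r → n / 2 ≡ r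
double/2 {r = r} refl = trans (cong (_/ 2) (r+r≡r*2 r)) (m*n/n≡m r 2)
  where
  r+r≡r*2 : ∀ r → r + r ≡ r * 2
  r+r≡r*2 = solve-∀

-- Rows of the array.

row : ℕ → Word → List Word
row n []      = (n ∷ []) ∷ []
row n (x ∷ w) = (n ∷ x ∷ w) ∷ map (x ∷_) (row n w)

length-row : ∀ n w → length (row n w) ≡ suc (length w)
length-row n []      = refl
length-row n (x ∷ w) = cong suc (trans (length-map (x ∷_) (row n w)) (length-row n w))

row-path : ∀ n w → Path (n ∷ w) (row n w) (w ++ [ n ])
row-path n []          = end (n ∷ [])
row-path n (x ∷ w) = AdjacentSwap-head n x w ∷ Path-map (AdjacentSwap-∷ x) (row-path n w)

∈-row : ∀ n xs ys → xs ++ n ∷ ys ∈ row n (xs ++ ys)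
∈-row n []       []       = here refl
∈-row n []       (y ∷ ys) = here refl
∈-row n (x ∷ xs) ys       = there (∈-map⁺ (x ∷_) (∈-row n xs ys))

∈-row⇒↭ : ∀ n w {u} → u ∈ row n w → u ↭ n ∷ w
∈-row⇒↭ n []      (here refl) = ↭-refl
∈-row⇒↭ n (x ∷ w) (here refl) = ↭-refl
∈-row⇒↭ n (x ∷ w) (there u∈) with ∈-map⁻ (x ∷_) u∈
... | v , v∈ , refl = ↭-trans (prep x (∈-row⇒↭ n w v∈)) (swap x n ↭-refl)

delete : ℕ → Word → Word
delete n = filter (λ k → ¬? (k ≟ n))

-- Any entry of a row determines the word it was built from; hence rows of different words are
-- disjoint.
delete-∈-row : ∀ n {w u} → All (_≢ n) w → u ∈ row n w → delete n u ≡ w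
delete-∈-row n {[]} [] (here refl) = filter-reject (λ k → ¬? (k ≟ n)) {n} {[]} λ n≢n → n≢n refl
delete-∈-row n {x ∷ w} w≢n (here refl) =
  trans (filter-reject (λ k → ¬? (k ≟ n)) {n} {x ∷ w} λ n≢n → n≢n refl)
    (filter-all (λ k → ¬? (k ≟ n)) w≢n)
delete-∈-row n {x ∷ w} (x≢n ∷ w≢n) (there u∈) with ∈-map⁻ (x ∷_) u∈
... | v , v∈ , refl =
  trans (filter-accept (λ k → ¬? (k ≟ n)) x≢n) (cong (x ∷_) (delete-∈-row n w≢n v∈))

row-unique : ∀ n {w} → All (_≢ n) w → Unique (row n w)
row-unique n {[]}    []           = [] ∷ []
row-unique n {x ∷ w} (x≢n ∷ w≢n) =
  All.map⁺ (All.universal (λ _ eq → x≢n (sym (∷-injectiveˡ eq))) (row n w)) ∷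
  Unique.map⁺ ∷-injectiveʳ (row-unique n w≢n)

rows-unique : ∀ n {ws} → All (All (_≢ n)) ws → Unique ws → Unique (concatMap (row n) ws)
rows-unique n {ws} ws≢n ws! =
  Unique.concat⁺ (All.map⁺ (All.map (row-unique n) ws≢n)) (AllPairs.map⁺ (disjoint ws≢n ws!))
  where
  disjoint : ∀ {vs} → All (All (_≢ n)) vs → Unique vs →
    AllPairs (λ v w → Disjoint (row n v) (row n w)) vs
  disjoint []            []         = []
  disjoint (v≢n ∷ vs≢n) (v∉ ∷ vs!) =
    All.zipWith (λ (v≢w , w≢n) → λ where
      (u∈v , u∈w) → v≢w (trans (sym (delete-∈-row n v≢n u∈v)) (delete-∈-row n w≢n u∈w)))
      (v∉ , vs≢n)
    ∷ disjoint vs≢n vs!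

-- `row` recurses at the front, while reversal moves the first symbol to the back; `row-reverse`
-- therefore needs this recursion at the back.
row-∷ʳ : ∀ n w x → row n (w ++ [ x ]) ≡ map (_++ [ x ]) (row n w) ++ [ w ++ x ∷ n ∷ [] ]
row-∷ʳ n []      x = refl
row-∷ʳ n (y ∷ w) x = cong ((n ∷ y ∷ w ++ [ x ]) ∷_) (begin
  map (y ∷_) (row n (w ++ [ x ]))
    ≡⟨ cong (map (y ∷_)) (row-∷ʳ n w x) ⟩
  map (y ∷_) (map (_++ [ x ]) (row n w) ++ [ w ++ x ∷ n ∷ [] ])
    ≡⟨ map-++ (y ∷_) (map (_++ [ x ]) (row n w)) _ ⟩
  map (y ∷_) (map (_++ [ x ]) (row n w)) ++ [ y ∷ w ++ x ∷ n ∷ [] ]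
    -- Prepending `y` and appending `x` commute definitionally, so both nested maps fuse to the same
    -- map.
    ≡⟨ cong (_++ [ y ∷ w ++ x ∷ n ∷ [] ]) (trans (sym (map-∘ (row n w))) (map-∘ (row n w))) ⟩
  map (_++ [ x ]) (map (y ∷_) (row n w)) ++ [ y ∷ w ++ x ∷ n ∷ [] ]
    ∎)
  where open ≡-Reasoning

-- Reversal exchanges column c with column `length w` - c. The entries come in the opposite order,
-- so the claim is only up to permutation.
row-reverse : ∀ n w → map reverse (row n w) ↭ row n (reverse w)
row-reverse n []      = ↭-refl
row-reverse n (x ∷ w) = begin
  reverse (n ∷ x ∷ w) ∷ map reverse (map (x ∷_) (row n w))
    ≡⟨ cong₂ _∷_ (reverse-++ (n ∷ x ∷ []) w) (map-reverse (row n w)) ⟩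
  (reverse w ++ x ∷ n ∷ []) ∷ map (_++ [ x ]) (map reverse (row n w))
    ↭⟨ prep _ (map⁺ (_++ [ x ]) (row-reverse n w)) ⟩
  (reverse w ++ x ∷ n ∷ []) ∷ map (_++ [ x ]) (row n (reverse w))
    ↭⟨ ∷↭∷ʳ _ _ ⟩
  map (_++ [ x ]) (row n (reverse w)) ++ [ reverse w ++ x ∷ n ∷ [] ]
    ≡⟨ row-∷ʳ n (reverse w) x ⟨
  row n (reverse w ++ [ x ])
    ≡⟨ cong (row n) (unfold-reverse x w) ⟨
  row n (reverse (x ∷ w))
    ∎
  where
  open PermutationReasoning
  map-reverse : ∀ us → map reverse (map (x ∷_) us) ≡ map (_++ [ x ]) (map reverse us)
  map-reverse []       = refl
  map-reverse (u ∷ us) = cong₂ _∷_ (unfold-reverse x u) (map-reverse us)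

rows-reverse : ∀ n ws →
  map reverse (concatMap (row n) ws) ↭ concatMap (row n) (map reverse ws)
rows-reverse n []       = ↭-refl
rows-reverse n (w ∷ ws) = ↭-trans
  (↭-reflexive (map-++ reverse (row n w) (concatMap (row n) ws)))
  (++⁺ (row-reverse n w) (rows-reverse n ws))

-- Traversing rows one after another, and two rows side by side.

zigzag : ℕ → List Word → List Word
zigzag n []            = []
zigzag n (v ∷ [])      = reverse (row n v)
zigzag n (v ∷ w ∷ ws) = reverse (row n v) ++ row n w ++ zigzag n ws

-- Every change of row happens with `n` in front or at the end, where it cannot separate the swapped
-- symbols. The first row is crossed from the last column to the first, and so is the last row when
-- their number is odd.
zigzag-path : ∀ n k {v ws w} → length ws ≡ suc (k * 2) → Path v ws w →
  Path (v ++ [ n ]) (zigzag n ws) (n ∷ w)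
zigzag-path n zero    len (end v)     = Path-reverse (row-path n v)
zigzag-path n zero    () (s ∷ end _)
zigzag-path n zero    () (s ∷ t ∷ p)
zigzag-path n (suc k) ()  (end v)
zigzag-path n (suc k) ()  (s ∷ end _)
zigzag-path n (suc k) len (s ∷ t ∷ p) =
  Path-reverse (row-path n _) ++⟨ AdjacentSwap-∷ n s ⟩
  row-path n _ ++⟨ AdjacentSwap-++ʳ [ n ] t ⟩
  zigzag-path n k (suc-injective (suc-injective len)) p

zigzag-↭ : ∀ n ws → zigzag n ws ↭ concatMap (row n) ws
zigzag-↭ n []            = ↭-refl
zigzag-↭ n (v ∷ [])      =
  ↭-trans (↭-reverse (row n v)) (↭-reflexive (sym (++-identityʳ (row n v))))
zigzag-↭ n (v ∷ w ∷ ws) = ++⁺ (↭-reverse (row n v)) (++⁺ˡ (row n w) (zigzag-↭ n ws))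

-- The recursive call exchanges `f` and `g`, so that each rung starts on the side where the previous
-- one ended.
ladder : (f g : Word → Word) → List Word → List Word
ladder f g []       = []
ladder f g (w ∷ ws) = f w ∷ g w ∷ ladder g f ws

-- Each rung changes sides, so an odd number of rungs ends on the `g` side.
ladder-path : ∀ {f g} →
  (∀ {v w} → AdjacentSwap v w → AdjacentSwap (f v) (f w)) →
  (∀ {v w} → AdjacentSwap v w → AdjacentSwap (g v) (g w)) →
  (∀ w → AdjacentSwap (f w) (g w)) →
  ∀ k {v ws w} → length ws ≡ suc (k * 2) → Path v ws w → Path (f v) (ladder f g ws) (g w)
ladder-path f-swap g-swap fg zero    len (end v)     = fg v ∷ end _
ladder-path f-swap g-swap fg zero    ()  (s ∷ end _)
ladder-path f-swap g-swap fg zero    ()  (s ∷ t ∷ p)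
ladder-path f-swap g-swap fg (suc k) ()  (end v)
ladder-path f-swap g-swap fg (suc k) ()  (s ∷ end _)
ladder-path f-swap g-swap fg (suc k) len (s ∷ t ∷ p) =
  fg _ ∷ g-swap s ∷ AdjacentSwap-sym (fg _) ∷ f-swap t ∷
  ladder-path f-swap g-swap fg k (suc-injective (suc-injective len)) p

ladder-↭ : ∀ f g ws → ladder f g ws ↭ map f ws ++ map g ws
ladder-↭ f g []       = ↭-refl
ladder-↭ f g (w ∷ ws) = prep (f w) (begin
  g w ∷ ladder g f ws          ↭⟨ prep (g w) (ladder-↭ g f ws) ⟩
  g w ∷ map g ws ++ map f ws   ↭⟨ ++-comm (map g (w ∷ ws)) (map f ws) ⟩
  map f ws ++ g w ∷ map g ws   ∎)
  where open PermutationReasoning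

-- Crossing the last three rows.

module LastThreeRows (n x y z : ℕ) (u : Word) where

  A B C : Word
  A = x ∷ y ∷ z ∷ u
  B = x ∷ z ∷ y ∷ u
  C = z ∷ x ∷ y ∷ u

  -- The stretch from bm to c2. From column 2 on, rows b and c are the row of `y ∷ u` behind the
  -- prefixes x z and z x.
  steps : List Word
  steps = ladder (λ w → x ∷ z ∷ w) (λ w → z ∷ x ∷ w) (reverse (row n (y ∷ u)))

  -- The first four words are a0 b0 b1 a1, the mapped row is a2 to am, and the last two words are c1
  -- c0.
  finish : List Word
  finish =
    (n ∷ A) ∷ (n ∷ B) ∷ (x ∷ n ∷ z ∷ y ∷ u) ∷ (x ∷ n ∷ y ∷ z ∷ u) ∷
    (map (λ w → x ∷ y ∷ w) (row n (z ∷ u)) ++ steps ++ (z ∷ n ∷ x ∷ y ∷ u) ∷ (n ∷ C) ∷ [])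

  -- `A` and `B` differ in their second and third symbols, so moves between a and b are barred in
  -- column 2 alone; they are made in columns 0, 1 and m. Moves between b and c are barred in column
  -- 1 alone, and the ladder uses columns m down to 2. As `length u` is odd, so is the number of
  -- rungs, and the ladder ends in row c.
  finish-path : ∀ k → length u ≡ suc (k * 2) → Path (n ∷ A) finish (n ∷ C)
  finish-path k len =
    AdjacentSwap-∷ n (AdjacentSwap-∷ x (AdjacentSwap-head y z u)) ∷
    AdjacentSwap-head n x _ ∷
    AdjacentSwap-∷ x (AdjacentSwap-∷ n (AdjacentSwap-head z y u)) ∷
    AdjacentSwap-∷ x (AdjacentSwap-head n y _) ∷
    (Path-map (AdjacentSwap-∷ x ∘ AdjacentSwap-∷ y) (row-path n (z ∷ u))
      ++⟨ AdjacentSwap-∷ x (AdjacentSwap-head y z _) ⟩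
    ladder-path (AdjacentSwap-∷ x ∘ AdjacentSwap-∷ z) (AdjacentSwap-∷ z ∘ AdjacentSwap-∷ x)
      (λ w → AdjacentSwap-head x z w) (suc k) ladder-length (Path-reverse (row-path n (y ∷ u)))
      ++⟨ AdjacentSwap-∷ z (AdjacentSwap-head x n _) ⟩
    (AdjacentSwap-head z n _ ∷ end (n ∷ C)))
    where
    ladder-length : length (reverse (row n (y ∷ u))) ≡ suc (suc k * 2)
    ladder-length = trans (length-reverse (row n (y ∷ u)))
      (trans (length-row n (y ∷ u)) (cong (2 +_) len))

  finish-↭ : finish ↭ row n A ++ row n B ++ row n C
  finish-↭ = begin
    finish
      ≡⟨ cong (λ r → (n ∷ A) ∷ (n ∷ B) ∷ b₁ ∷ a₁ ∷ (r ++ steps ++ c₁ ∷ (n ∷ C) ∷ []))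
           (map-∘ (row n (z ∷ u))) ⟩
    (n ∷ A) ∷ (n ∷ B) ∷ b₁ ∷ a₁ ∷ (as ++ steps ++ c₁ ∷ (n ∷ C) ∷ [])
      ↭⟨ prep _ (shift a₁ ((n ∷ B) ∷ b₁ ∷ []) _) ⟩
    (n ∷ A) ∷ a₁ ∷ ((n ∷ B) ∷ b₁ ∷ []) ++ as ++ steps ++ c₁ ∷ (n ∷ C) ∷ []
      ↭⟨ prep _ (prep _ (shifts ((n ∷ B) ∷ b₁ ∷ []) as)) ⟩
    row n A ++ (n ∷ B) ∷ b₁ ∷ (steps ++ c₁ ∷ (n ∷ C) ∷ [])
      ↭⟨ ++⁺ˡ (row n A) (prep _ (prep _ (++⁺ʳ _ steps-↭))) ⟩
    row n A ++ (n ∷ B) ∷ b₁ ∷ ((bs ++ cs) ++ c₁ ∷ (n ∷ C) ∷ [])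
      ≡⟨ cong (λ r → row n A ++ (n ∷ B) ∷ b₁ ∷ r) (++-assoc bs cs _) ⟩
    row n A ++ row n B ++ cs ++ c₁ ∷ (n ∷ C) ∷ []
      ↭⟨ ++⁺ˡ (row n A) (++⁺ˡ (row n B) (++-comm cs _)) ⟩
    row n A ++ row n B ++ c₁ ∷ (n ∷ C) ∷ cs
      ↭⟨ ++⁺ˡ (row n A) (++⁺ˡ (row n B) (swap _ _ ↭-refl)) ⟩
    row n A ++ row n B ++ row n C
      ∎
    where
    open PermutationReasoning
    a₁ = x ∷ n ∷ y ∷ z ∷ u
    b₁ = x ∷ n ∷ z ∷ y ∷ u
    c₁ = z ∷ n ∷ x ∷ y ∷ u
    -- The maps are nested so that `row n A` is definitionally `(n ∷ A) ∷ a₁ ∷ as`, and likewise for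
    -- the other two rows.
    as = map (x ∷_) (map (y ∷_) (row n (z ∷ u)))
    bs = map (x ∷_) (map (z ∷_) (row n (y ∷ u)))
    cs = map (z ∷_) (map (x ∷_) (row n (y ∷ u)))
    steps-↭ : steps ↭ bs ++ cs
    steps-↭ = ↭-trans (ladder-↭ _ _ (reverse (row n (y ∷ u)))) (++⁺
      (↭-trans (map⁺ _ (↭-reverse (row n (y ∷ u)))) (↭-reflexive (map-∘ (row n (y ∷ u)))))
      (↭-trans (map⁺ _ (↭-reverse (row n (y ∷ u)))) (↭-reflexive (map-∘ (row n (y ∷ u))))))

-- Completing the first half of a code by its reversals.

ReverseGrayCode-fromHalf : ∀ m {v w} L → m ! ≡ length L + length L →
  Path v L w → AdjacentSwap w (reverse v) →
  Unique (L ++ map reverse L) →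
  (∀ {u} → u ∈ L ++ map reverse L → IsPermutationWord m u) →
  (∀ {u} → IsPermutationWord m u → u ∈ L ++ map reverse L) →
  ∃[ ρ ] IsReverseGrayCode m ρ
ReverseGrayCode-fromHalf m L m!≡ path join unique sound complete = ρ , record
  { permutations = λ i → sound (∈-lookup (cast m!≡F i))
  ; distinct     = λ {i} {j} eq → toℕ-injective (trans (sym (toℕ-cast m!≡F i))
      (trans (cong toℕ (Unique-lookup-injective unique eq)) (toℕ-cast m!≡F j)))
  ; exhaustive   = λ w w-perm → let w∈F = complete w-perm in
      cast (sym m!≡F) (index w∈F) ,
      trans (cong (lookup F) (cast-involutive m!≡F (sym m!≡F) (index w∈F)))
        (sym (lookup-index w∈F))
  -- Reversal carries the path through `L` to a path through the second half, so `join` is the one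
  -- further swap required.
  ; adjacent     = λ i j eq → Path-lookup (path ++⟨ join ⟩ Path-map AdjacentSwap-reverse path) _ _
      (trans (toℕ-cast m!≡F j) (trans eq (cong suc (sym (toℕ-cast m!≡F i)))))
  ; reversal     = λ i j eq → lookup-++-map reverse L _ _ (trans (toℕ-cast m!≡F j)
      (trans eq (cong₂ _+_ (sym (toℕ-cast m!≡F i)) half)))
  }
  where
  F = L ++ map reverse L
  m!≡F : m ! ≡ length F
  m!≡F = trans m!≡ (sym (trans (length-++ L) (cong (length L +_) (length-map reverse L))))
  ρ : Listing m
  ρ = lookup F ∘ cast m!≡F
  half : m ! / 2 ≡ length L
  half = double/2 m!≡

-- Permutation words and the rows containing them.

identityWord-∷ʳ : ∀ m → identityWord m ++ [ suc m ] ≡ identityWord (suc m)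
identityWord-∷ʳ = applyUpTo-∷ʳ suc

top-fresh : ∀ {m w} → IsPermutationWord m w → All (_≢ suc m) w
top-fresh {m} w-perm =
  All-resp-↭ (↭-sym w-perm) (All.applyUpTo⁺₁ suc m (λ i<m → <⇒≢ (s≤s i<m)))

∈-row⇒perm : ∀ {m w u} → IsPermutationWord m w → u ∈ row (suc m) w → IsPermutationWord (suc m) u
∈-row⇒perm {m} {w} {u} w-perm u∈ = begin
  u                             ↭⟨ ∈-row⇒↭ (suc m) w u∈ ⟩
  suc m ∷ w                     ↭⟨ prep (suc m) w-perm ⟩
  suc m ∷ identityWord m        ↭⟨ ∷↭∷ʳ (suc m) (identityWord m) ⟩
  identityWord m ++ [ suc m ]   ≡⟨ identityWord-∷ʳ m ⟩
  identityWord (suc m)          ∎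
  where open PermutationReasoning

-- Split `u` at its symbol `suc m` and cancel that symbol against the end of the identity word.
perm⇒∈-row : ∀ {m u} → IsPermutationWord (suc m) u →
  ∃[ w ] (IsPermutationWord m w × u ∈ row (suc m) w)
perm⇒∈-row {m} {u} u-perm
  with u↭ ← ↭-trans u-perm (↭-reflexive (sym (identityWord-∷ʳ m)))
  with xs , ys , refl ← ∈-∃++ (∈-resp-↭ (↭-sym u↭) (∈-++⁺ʳ (identityWord m) (here refl)))
  = xs ++ ys ,
    ↭-trans (drop-mid xs (identityWord m) u↭) (↭-reflexive (++-identityʳ (identityWord m))) ,
    ∈-row (suc m) xs ys

length-rows : ∀ n {m ws} → All (λ w → length w ≡ m) ws →
  length (concatMap (row n) ws) ≡ length ws * suc m
length-rows n [] = refl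
length-rows n {ws = w ∷ ws} (len ∷ lens) = trans (length-++ (row n w))
  (cong₂ _+_ (trans (length-row n w) (cong suc len)) (length-rows n lens))

-- The half length (n-1)!/2 enters as an odd number plus three.
oddPlus3 : ℕ → ℕ
oddPlus3 k = suc (k * 2) + 3

-- The extended code, for a half length of the form `oddPlus3 k`.

module Extension
  (m k : ℕ)
  -- With this index type in place of `Fin (m !)`, the two halves and the last three rows of the
  -- first half are addressed by `_↑ˡ_` and `_↑ʳ_`.
  (f : Fin (oddPlus3 k + oddPlus3 k) → Word)
  (m!≡R+R : m ! ≡ oddPlus3 k + oddPlus3 k)
  (f-perm : ∀ i → IsPermutationWord m (f i))
  (f-inj : Injective _≡_ _≡_ f)
  (f-surj : ∀ w → IsPermutationWord m w → ∃[ i ] f i ≡ w)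
  (f-swap : ∀ i j → toℕ j ≡ suc (toℕ i) → AdjacentSwap (f i) (f j))
  (f-reverse : ∀ i → f (oddPlus3 k ↑ʳ i) ≡ reverse (f (i ↑ˡ oddPlus3 k)))
  (x y z : ℕ) (u : Word) (l : ℕ) (length-u : length u ≡ suc (l * 2))
  -- Property P enters here, through the words of index R-3, R-2 and R-1.
  (f≡A : f ((suc (k * 2) ↑ʳ zero) ↑ˡ oddPlus3 k) ≡ x ∷ y ∷ z ∷ u)
  (f≡B : f ((suc (k * 2) ↑ʳ suc zero) ↑ˡ oddPlus3 k) ≡ x ∷ z ∷ y ∷ u)
  (f≡C : f ((suc (k * 2) ↑ʳ suc (suc zero)) ↑ˡ oddPlus3 k) ≡ z ∷ x ∷ y ∷ u)
  where

  n Q R : ℕ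
  n = suc m
  Q = suc (k * 2)
  R = oddPlus3 k

  open LastThreeRows n x y z u

  initial : Fin Q → Word
  initial i = f ((i ↑ˡ 3) ↑ˡ R)

  toℕ-initial : ∀ (i : Fin Q) → toℕ ((i ↑ˡ 3) ↑ˡ R) ≡ toℕ i
  toℕ-initial i = trans (toℕ-↑ˡ (i ↑ˡ 3) R) (toℕ-↑ˡ i 3)

  toℕ-final : ∀ (i : Fin 3) → toℕ ((Q ↑ʳ i) ↑ˡ R) ≡ Q + toℕ i
  toℕ-final i = trans (toℕ-↑ˡ (Q ↑ʳ i) R) (toℕ-↑ʳ Q i)

  firstHalf : List Word
  firstHalf = tabulate initial ++ A ∷ B ∷ C ∷ []

  tabulate-f : tabulate f ≡ firstHalf ++ map reverse firstHalf
  tabulate-f = trans (tabulate-+ R R f) (cong₂ _++_ half≡ (begin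
    tabulate (λ i → f (R ↑ʳ i))                 ≡⟨ tabulate-cong f-reverse ⟩
    tabulate (λ i → reverse (f (i ↑ˡ R)))       ≡⟨ map-tabulate (λ i → f (i ↑ˡ R)) reverse ⟨
    map reverse (tabulate (λ i → f (i ↑ˡ R)))   ≡⟨ cong (map reverse) half≡ ⟩
    map reverse firstHalf                       ∎))
    where
    open ≡-Reasoning
    half≡ : tabulate (λ i → f (i ↑ˡ R)) ≡ firstHalf
    half≡ = trans (tabulate-+ Q 3 (λ i → f (i ↑ˡ R)))
      (cong (tabulate initial ++_) (cong₂ _∷_ f≡A (cong₂ _∷_ f≡B (cong (_∷ []) f≡C))))

  half : List Word
  half = zigzag n (tabulate initial) ++ finish

  half-path : Path (f zero ++ [ n ]) half (n ∷ C)
  half-path =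
    zigzag-path n k (length-tabulate initial) (Path-tabulate (k * 2) initial initial-swap)
      -- Both words at this seam have `n` in front, so the swap from row Q-1 to row Q of the given
      -- code carries over.
      ++⟨ AdjacentSwap-∷ n (subst (AdjacentSwap _) f≡A (f-swap _ _ initial-A)) ⟩
    finish-path l length-u
    where
    initial-swap : ∀ i j → toℕ j ≡ suc (toℕ i) → AdjacentSwap (initial i) (initial j)
    initial-swap i j eq =
      f-swap _ _ (trans (toℕ-initial j) (trans eq (cong suc (sym (toℕ-initial i)))))
    initial-A : toℕ ((Q ↑ʳ zero {n = 2}) ↑ˡ R) ≡ suc (toℕ ((fromℕ (k * 2) ↑ˡ 3) ↑ˡ R))
    initial-A = trans (toℕ-final zero) (trans (+-identityʳ Q)
      (cong suc (sym (trans (toℕ-initial (fromℕ (k * 2))) (toℕ-fromℕ (k * 2))))))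

  -- Reversal brings the final `n` to the front. Behind it remains the step of the given code from
  -- `C`, of index R-1, to its word of index R, the reversal of its first word.
  join : AdjacentSwap (n ∷ C) (reverse (f zero ++ [ n ]))
  join = subst (AdjacentSwap _) (sym (reverse-++ (f zero) [ n ]))
    (AdjacentSwap-∷ n (subst₂ AdjacentSwap f≡C (f-reverse zero) (f-swap _ _ C-reverse)))
    where
    C-reverse : toℕ (R ↑ʳ zero {n = k * 2 + 3}) ≡ suc (toℕ ((Q ↑ʳ suc (suc (zero {n = 0}))) ↑ˡ R))
    C-reverse = trans (toℕ-↑ʳ R zero) (trans (+-identityʳ R)
      (trans (+-suc Q 2) (cong suc (sym (toℕ-final (suc (suc zero)))))))

  half-↭ : half ↭ concatMap (row n) firstHalf
  half-↭ = begin
    zigzag n (tabulate initial) ++ finish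
      ↭⟨ ++⁺ (zigzag-↭ n (tabulate initial)) finish-↭ ⟩
    concatMap (row n) (tabulate initial) ++ row n A ++ row n B ++ row n C
      ≡⟨ cong (λ r → concatMap (row n) (tabulate initial) ++ row n A ++ row n B ++ r)
           (++-identityʳ (row n C)) ⟨
    concatMap (row n) (tabulate initial) ++ concatMap (row n) (A ∷ B ∷ C ∷ [])
      ≡⟨ concatMap-++ (row n) (tabulate initial) (A ∷ B ∷ C ∷ []) ⟨
    concatMap (row n) firstHalf
      ∎
    where open PermutationReasoning

  -- The reversed first half of the array consists of the rows of the reversed words, which form the
  -- second half of the given code. Uniqueness, soundness, completeness and length can thus be
  -- checked on the whole array.
  listing-↭ : half ++ map reverse half ↭ concatMap (row n) (tabulate f)
  listing-↭ = begin
    half ++ map reverse half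
      ↭⟨ ++⁺ half-↭ (↭-trans (map⁺ reverse half-↭) (rows-reverse n firstHalf)) ⟩
    concatMap (row n) firstHalf ++ concatMap (row n) (map reverse firstHalf)
      ≡⟨ concatMap-++ (row n) firstHalf (map reverse firstHalf) ⟨
    concatMap (row n) (firstHalf ++ map reverse firstHalf)
      ≡⟨ cong (concatMap (row n)) tabulate-f ⟨
    concatMap (row n) (tabulate f)
      ∎
    where open PermutationReasoning

  length-half : n ! ≡ length half + length half
  length-half = begin
    n * m !                                    ≡⟨ *-comm n (m !) ⟩
    m ! * n                                    ≡⟨ cong (_* n) (trans m!≡R+R (sym (length-tabulate f))) ⟩
    length (tabulate f) * n                    ≡⟨ length-rows n (All.tabulate⁺ {f = f} length-f) ⟨
    length (concatMap (row n) (tabulate f))    ≡⟨ ↭-length listing-↭ ⟨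
    length (half ++ map reverse half)          ≡⟨ length-++ half ⟩
    length half + length (map reverse half)    ≡⟨ cong (length half +_) (length-map reverse half) ⟩
    length half + length half                  ∎
    where
    open ≡-Reasoning
    length-f : ∀ i → length (f i) ≡ m
    length-f i = trans (↭-length (f-perm i)) (length-applyUpTo suc m)

  extension : ∃[ ρ ] IsReverseGrayCode n ρ
  extension = ReverseGrayCode-fromHalf n half length-half half-path join
    (Unique-resp-↭ (↭-sym listing-↭)
      (rows-unique n (All.tabulate⁺ {f = f} (λ i → top-fresh (f-perm i))) (Unique.tabulate⁺ f-inj)))
    sound complete
    where
    sound : ∀ {v} → v ∈ half ++ map reverse half → IsPermutationWord n v
    sound v∈
      with w , w∈ , v∈row ← find (∈-concatMap⁻ (row n) {xs = tabulate f} (∈-resp-↭ listing-↭ v∈))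
      with i , refl ← ∈-tabulate⁻ {f = f} w∈
      = ∈-row⇒perm (f-perm i) v∈row
    complete : ∀ {v} → IsPermutationWord n v → v ∈ half ++ map reverse half
    complete v-perm
      with w , w-perm , v∈row ← perm⇒∈-row v-perm
      with i , refl ← f-surj w w-perm
      = ∈-resp-↭ (↭-sym listing-↭) (∈-concatMap⁺ (row n) (lose (∈-tabulate⁺ {f = f} i) v∈row))

-- Reading off property P and the parities.

baseWord-tail : ∀ p → ∃₂ λ y u →
  applyDownFrom (3 +_) p ++ 1 ∷ 2 ∷ [] ≡ y ∷ u × length u ≡ suc p
-- This is the case n = 5, where m-1 is followed by 1 in the base word 3 1 2.
baseWord-tail zero    = 1 , 2 ∷ [] , refl , refl
baseWord-tail (suc p) = _ , _ , refl ,
  trans (length-++ (applyDownFrom (3 +_) p))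
    (trans (cong (_+ 2) (length-applyDownFrom (3 +_) p)) (+-comm p 2))

theorem9 : (n : ℕ) → n % 4 ≡ 1 → 5 ≤ n →
    ∃[ π ] (IsReverseGrayCode (n ∸ 1) π × PropertyP (n ∸ 1) π) →
    ∃[ ρ ] IsReverseGrayCode n ρ
theorem9 n n%4≡1 5≤n codeP
  -- Writing `n` as 1 + 4 (n / 4) lets `refl` turn `n ∸ 1` into 4 + 4 t; quotient zero would mean n
  -- = 1.
  with n / 4 | trans (m≡m%n+[m/n]*n n 4) (cong (_+ n / 4 * 4) n%4≡1)
... | zero  | refl = contradiction 5≤n λ { (s≤s ()) }
-- 24 = 4! divides `m !` since m is at least 4; hence `m ! / 2` is even.
... | suc t | refl = extend codeP (m≤n⇒m!∣n! {4} {4 + t * 4} (m≤m+n 4 (t * 4)))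
  where
  m = 4 + t * 4
  extend : ∃[ π ] (IsReverseGrayCode m π × PropertyP m π) → 24 ∣ m ! →
    ∃[ ρ ] IsReverseGrayCode (suc m) ρ
  extend _ (divides zero m!≡) = contradiction m!≡ (≢-nonZero⁻¹ (m !) {{m !≢0}})
  extend (π , code , P) (divides (suc q) m!≡)
    with y , u , v≡ , len ← baseWord-tail (t * 4)
    = Extension.extension m k f m!≡R+R
        (λ i → permutations _)
        (λ {i} {j} eq → toℕ-injective (trans (sym (toℕ-cast R+R≡m! i))
          (trans (cong toℕ (distinct eq)) (toℕ-cast R+R≡m! j))))
        (λ w w-perm → let i , πi≡w = exhaustive w w-perm in
          cast m!≡R+R i , trans (cong π (cast-involutive R+R≡m! m!≡R+R i)) πi≡w)
        (λ i j eq → adjacent _ _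
          (trans (toℕ-cast R+R≡m! j) (trans eq (cong suc (sym (toℕ-cast R+R≡m! i))))))
        (λ i → reversal _ _ (trans (toℕ-cast R+R≡m! (R ↑ʳ i)) (trans (toℕ-↑ʳ R i)
          (trans (+-comm R (toℕ i)) (cong₂ _+_
            (sym (trans (toℕ-cast R+R≡m! (i ↑ˡ R)) (toℕ-↑ˡ i R))) (sym (double/2 m!≡R+R)))))))
        -- Here x = m-1, z = m, and `y` follows m-1 in the base word; `u` has 4 t + 1 symbols, an
        -- odd number.
        (3 + t * 4) y m u (t * 2) (trans len (cong suc (sym (*-assoc t 2 2))))
        (trans (third-before _ (before zero)) (cong (λ v → insertAt 2 (3 + t * 4 ∷ v)) v≡))
        (trans (second-before _ (before (suc zero))) (cong (λ v → insertAt 1 (3 + t * 4 ∷ v)) v≡))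
        (trans (first-before _ (before (suc (suc zero)))) (cong (λ v → insertAt 0 (3 + t * 4 ∷ v)) v≡))
    where
    open IsReverseGrayCode code
    open PropertyP P
    -- From `m !` = 24 (q + 1) the half length is 12 (q + 1) = (2 k + 1) + 3.
    k = 6 * q + 4
    R = oddPlus3 k
    m!≡R+R : m ! ≡ R + R
    m!≡R+R = trans m!≡ (arith q)
      where
      arith : ∀ q → suc q * 24 ≡ (suc ((6 * q + 4) * 2) + 3) + (suc ((6 * q + 4) * 2) + 3)
      arith = solve-∀
    f : Fin (R + R) → Word
    f i = π (cast (sym m!≡R+R) i)
    R+R≡m! = sym m!≡R+R
    insertAt : ℕ → Word → Word
    insertAt c v = take c v ++ m ∷ drop c v
    -- Matches the indices R-3, R-2 and R-1 with the third, second and first words before the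
    -- middle.
    before : ∀ i → toℕ (cast R+R≡m! ((suc (k * 2) ↑ʳ i) ↑ˡ R)) + (3 ∸ toℕ i) ≡ m ! / 2
    before i = begin
      toℕ (cast R+R≡m! ((suc (k * 2) ↑ʳ i) ↑ˡ R)) + (3 ∸ toℕ i)
        ≡⟨ cong (_+ _) (trans (toℕ-cast R+R≡m! _) (trans (toℕ-↑ˡ _ R) (toℕ-↑ʳ (suc (k * 2)) i))) ⟩
      suc (k * 2) + toℕ i + (3 ∸ toℕ i)
        ≡⟨ +-assoc (suc (k * 2)) (toℕ i) _ ⟩
      suc (k * 2) + (toℕ i + (3 ∸ toℕ i))
        ≡⟨ cong (suc (k * 2) +_) (m+[n∸m]≡n (<⇒≤ (toℕ<n i))) ⟩
      R
        ≡⟨ double/2 m!≡R+R ⟨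
      m ! / 2
        ∎
      where open ≡-Reasoning
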